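{- For a sequence $(p_i)_{i\in\mathbf{N}}$ of prime numbers, let $\mathcal{A}(p)$ denote the British number system generated by $(p_i)_{i\in\mathbf{N}}$. The map $(p_i)_{i\in\mathbf{N}} \mapsto \mathcal{A}(p)$ is a one-to-one correspondence between the set of all infinite sequences of prime numbers and the set of all indecomposable British number systems. Moreover, every additive system is either indecomposable or a contraction of an indecomposable additive system.
   Context: $\mathbf{N}=\{1,2,3,\ldots\}$ and $\mathbf{N}_0=\{0,1,2,\ldots\}$. For integers $a<b$, $[a,b)=\{x\in\mathbf{Z}: a\le x<b\}$. For an integer $g$ and a set $X$ of integers, $g\ast X=\{gx:x\in X\}$. Additive system: a family $\mathcal{A}=(A_i)_{i\in I}$, indexed by a nonempty finite or infinite set $I$, of sets of nonnegative integers with $0\in A_i$ and $|A_i|\ge 2$ for all $i\in I$ (each $A_i$ may be finite or infinite), such that every $n\in\mathbf{N}_0$ has a unique representation $n=\sum_{i\in I}a_i$ with $a_i\in A_i$ for all $i$ and $a_i\neq 0$ for only finitely many $i$. British number system generated by a sequence of integers $(g_i)_{i\in\mathbf{N}}$ with $g_i\ge 2$ for all $i$: put $G_0=1$ and $G_i=\prod_{j=1}^i g_j$; it is the additive system $(A_i)_{i\in\mathbf{N}}$ with $A_i=G_{i-1}\ast[0,g_i)$. (It is known that this is an additive system, and, by a theorem of de Bruijn, that every additive system is a British number system or a contraction of one.) Contraction: if $\mathcal{B}=(B_j)_{j\in J}$ is an additive system and $(J_i)_{i\in I}$ is a partition of $J$ into pairwise disjoint nonempty sets, then the additive system $(A_i)_{i\in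 I}$ with $A_i=\sum_{j\in J_i}B_j$ (the set of all sums $\sum_{j\in J_i}b_j$ with $b_j\in B_j$ and only finitely many $b_j$ nonzero) is called a contraction of $\mathcal{B}$. A set $A$ of integers is decomposable if there are sets of integers $B,C$ with $|B|\ge 2$, $|C|\ge2$, $A=\{b+c:b\in B,c\in C\}$, and every element of $A$ has exactly one representation as $b+c$ with $b\in B$, $c\in C$; otherwise $A$ is indecomposable. An additive system $(A_i)_{i\in I}$ is indecomposable if every $A_i$ is an indecomposable set. -}

module Defs where

open import Data.Integer as ℤ using (ℤ; +_)
open import Data.List using (List; applyUpTo; map)
open import Data.List.Membership.Propositional using () renaming (_∈_ to _∈ₗ_)
open import Data.List.Relation.Unary.All using (All)
open import Data.List.Relation.Unary.Unique.Propositional using (Unique)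
open import Data.Nat using (ℕ; _*_; _≤_; _<_)
open import Data.Nat.ListAction using (sum; product)
open import Data.Nat.Primality using (Prime)
open import Data.Product using (∃; ∃₂; ∃!; _×_; _,_)
open import Level using (0ℓ; suc)
open import Relation.Binary using (Setoid)
open import Relation.Binary.PropositionalEquality using (_≡_; _≢_; _≗_; refl; sym; trans)
open import Relation.Nullary using (¬_)
open import Relation.Unary using (Pred; _∈_; _≐_; _⊥_; U; Satisfiable)
open import Relation.Unary.Properties using (≐-refl; ≐-sym; ≐-trans)

Subset : Set → Set₁
Subset X = Pred X 0ℓ

Family : Set → Set₁
Family I = I → Subset ℕ

AtLeastTwo : {X : Set} → Subset X → Set
AtLeastTwo A = ∃₂ λ x y → x ∈ A × y ∈ A × x ≢ y

image : {X Y : Set} → (X → Y) → Subset X → Subset Y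
image f A y = ∃ λ x → x ∈ A × f x ≡ y

infixr 7 _∗_
_∗_ : ℕ → Subset ℕ → Subset ℕ
g ∗ A = image (g *_) A

-- The values of a at indices in K vanish outside a finite set, and their sum is n.
-- (Values at indices outside K play no role.)
record IsSum {I : Set} (K : Subset I) (a : I → ℕ) (n : ℕ) : Set where
  field
    support : List I
    unique  : Unique support
    inside  : All K support
    covers  : ∀ {i} → i ∈ K → a i ≢ 0 → i ∈ₗ support
    total   : sum (map a support) ≡ n

record IsAdditiveSystem {I : Set} (A : Family I) : Set where
  field
    index          : I
    zero∈          : ∀ i → 0 ∈ A i
    atLeastTwo     : ∀ i → AtLeastTwo (A i)
    representation : ∀ n → ∃! _≗_ λ a → (∀ i → a i ∈ A i) × IsSum U a n

Sumset : {J : Set} → Subset J → Family J → Subset ℕ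
Sumset K B n = ∃ λ b → (∀ j → j ∈ K → b j ∈ B j) × IsSum K b n

record IsPartition {I J : Set} (P : I → Subset J) : Set where
  field
    nonempty : ∀ i → Satisfiable (P i)
    disjoint : ∀ {i i′} → i ≢ i′ → P i ⊥ P i′
    covering : ∀ j → ∃ λ i → j ∈ P i

_IsContractionOf_ : {I J : Set} → Family I → Family J → Set₁
_IsContractionOf_ {I} {J} A B =
  ∃ λ (P : I → Subset J) → IsPartition P × (∀ i → A i ≐ Sumset (P i) B)

Decomposable : Subset ℤ → Set₁
Decomposable A = ∃₂ λ (B C : Subset ℤ) →
  AtLeastTwo B × AtLeastTwo C ×
  A ≐ (λ a → ∃₂ λ b c → b ∈ B × c ∈ C × b ℤ.+ c ≡ a) ×
  (∀ a → a ∈ A → ∃! {A = ℤ × ℤ} _≡_ λ (b , c) → b ∈ B × c ∈ C × b ℤ.+ c ≡ a)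

-- The summands in a decomposition may contain negative integers, so members of a
-- family are regarded as sets of integers here.
IsIndecomposable : {I : Set} → Family I → Set₁
IsIndecomposable A = ∀ i → ¬ Decomposable (image +_ (A i))

-- Sequences start at index 0: g i, british g i stand for g_{i+1}, A_{i+1}, so that
-- the factor G_{i-1} for A_i becomes the product of g 0, …, g (i ∸ 1).
G : (ℕ → ℕ) → ℕ → ℕ
G g i = product (applyUpTo g i)

british : (ℕ → ℕ) → Family ℕ
british g i = G g i ∗ (_< g i)

IsBritish : Family ℕ → Set
IsBritish A = ∃ λ g → (∀ i → 2 ≤ g i) × (∀ i → A i ≐ british g i)

record PrimeSequence : Set where
  field
    terms : ℕ → ℕ
    prime : ∀ i → Prime (terms i)

open PrimeSequence public

record IndecomposableBritishSystem : Set₁ where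
  field
    sets           : Family ℕ
    additive       : IsAdditiveSystem sets
    isBritish      : IsBritish sets
    indecomposable : IsIndecomposable sets

open IndecomposableBritishSystem public using (sets)

primeSequences : Setoid 0ℓ 0ℓ
primeSequences = record
  { Carrier       = PrimeSequence
  ; _≈_           = λ p q → terms p ≗ terms q
  ; isEquivalence = record
    { refl  = λ _ → refl
    ; sym   = λ e i → sym (e i)
    ; trans = λ e f i → trans (e i) (f i)
    }
  }

indecomposableBritishSystems : Setoid (suc 0ℓ) 0ℓ
indecomposableBritishSystems = record
  { Carrier       = IndecomposableBritishSystem
  ; _≈_           = λ A B → ∀ i → sets A i ≐ sets B i
  ; isEquivalence = record
    { refl  = λ _ → ≐-refl
    ; sym   = λ e i → ≐-sym (e i)
    ; trans = λ e f i → ≐-trans (e i) (f i)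
    }
  }

{-# OPTIONS --safe #-}

-- A decomposition of h ∗ [0, g) is finite and splits g as a product of two factors ≥ 2, and
-- conversely [0, a b) = [0, a) + a ∗ [0, b); so h ∗ [0, g) is indecomposable iff g is prime.
--
-- For the second claim, de Bruijn's argument is run with prime digit bases. Let 1 ∈ Aᵢ, let C be
-- the sumset of the other members, and let g be the least number outside Aᵢ (if Aᵢ = ℕ, any
-- prime serves as p below). Then g ∈ C, every element of C is a multiple of g, and Aᵢ is a union
-- of blocks [kg, kg + g). Both properties pass to a prime divisor p of g, so the family of the
-- sets {b : p b ∈ Aⱼ} is again an additive system, possibly with members {0}. Iterating gives
-- sequences of primes and of pivots i, and Aⱼ consists of the numbers whose digits to these
-- prime bases vanish wherever the pivot is not j.
-- Since this exhibits every additive system as a contraction, no system needs to be tested for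
-- indecomposability, which excluded middle for Set could not decide.
module Submission where

open import Defs
open import Axiom.ExcludedMiddle using (ExcludedMiddle)
open import Data.Integer as ℤ using (ℤ)
import Data.Integer.Properties as ℤ
open import Data.List
  using (List; []; _∷_; applyUpTo; cartesianProduct; deduplicate; filter; length; map; upTo)
open import Data.List.Membership.Propositional using () renaming (_∈_ to _∈ₗ_)
open import Data.List.Membership.Propositional.Properties
  using (∈-cartesianProduct⁺; ∈-cartesianProduct⁻; ∈-deduplicate⁺; ∈-deduplicate⁻;
         ∈-filter⁺; ∈-filter⁻; ∈-map⁺; ∈-map⁻; ∈-upTo⁺; ∈-upTo⁻)
open import Data.List.Membership.Propositional.Properties.WithK using (unique∧set⇒bag)
open import Data.List.Properties
  using (length-++; length-map; length-upTo; map-cong-local; map-upTo)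
open import Data.List.Relation.Binary.BagAndSetEquality using (∼bag⇒↭)
open import Data.List.Relation.Binary.Permutation.Propositional using (_↭_)
open import Data.List.Relation.Binary.Permutation.Propositional.Properties
  using (↭-length) renaming (map⁺ to ↭-map⁺)
open import Data.List.Relation.Unary.All as All using (All; []; _∷_)
open import Data.List.Relation.Unary.AllPairs using ([]; _∷_)
open import Data.List.Relation.Unary.Any using (here; there)
open import Data.List.Relation.Unary.Unique.Propositional using (Unique)
import Data.List.Relation.Unary.Unique.DecPropositional.Properties as DecUnique
import Data.List.Relation.Unary.Unique.Propositional.Properties as Unique
open import Data.Nat
open import Data.Nat.DivMod
open import Data.Nat.Divisibility
open import Data.Nat.Induction using (<-rec)
open import Data.Nat.ListAction using (sum; product)
open import Data.Nat.ListAction.Properties using (sum-↭)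
open import Data.Nat.Primality
  using (Prime; Composite; composite; prime?; ¬prime⇒composite; prime⇒irreducible;
         prime⇒nonTrivial; prime[2])
open import Data.Nat.Primality.Factorisation using (factorise)
open import Data.Nat.Properties
open import Data.Product using (Σ-syntax; ∃; ∃₂; ∃!; _×_; _,_; proj₁; proj₂)
open import Data.Sum using (_⊎_; inj₁; inj₂)
open import Function using (_∘_)
open import Function.Bundles using (Bijection; mk⇔)
open import Level using (0ℓ)
open import Relation.Binary.Definitions using (DecidableEquality)
open import Relation.Binary.PropositionalEquality
open import Relation.Nullary using (¬_; yes; no; contradiction; ¬?)
open import Relation.Nullary.Decidable using (decidable-stable)
open import Relation.Unary using (_∈_; _∉_; _⊆_; _≐_; U; Decidable)
open import Relation.Unary.Properties using (≐-refl; ≐-sym; ≐-trans)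

-- Finitely supported sums over an arbitrary index set.

unique-↭ : {X : Set} {xs ys : List X} → Unique xs → Unique ys →
           (∀ {z} → z ∈ₗ xs → z ∈ₗ ys) → (∀ {z} → z ∈ₗ ys → z ∈ₗ xs) → xs ↭ ys
unique-↭ xs! ys! xs⊆ys ys⊆xs = ∼bag⇒↭ (unique∧set⇒bag xs! ys! (mk⇔ xs⊆ys ys⊆xs))

module _ {I : Set} where

  private
    nonzero? : (a : I → ℕ) → Decidable (λ i → a i ≢ 0)
    nonzero? a i = ¬? (a i ≟ 0)

  sum-filter-nonzero : ∀ (a : I → ℕ) xs →
                       sum (map a (filter (nonzero? a) xs)) ≡ sum (map a xs)
  sum-filter-nonzero a [] = refl
  sum-filter-nonzero a (x ∷ xs) with a x in eq
  ... | zero  = sum-filter-nonzero a xs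
  ... | suc n = cong₂ _+_ eq (sum-filter-nonzero a xs)

  -- Dropping the indices where `a` vanishes changes neither sum, and what remains of the two
  -- duplicate-free lists has the same members, hence is a permutation.
  sum-support : ∀ (a : I → ℕ) {xs ys} → Unique xs → Unique ys →
                (∀ {i} → i ∈ₗ xs → a i ≢ 0 → i ∈ₗ ys) →
                (∀ {i} → i ∈ₗ ys → a i ≢ 0 → i ∈ₗ xs) →
                sum (map a xs) ≡ sum (map a ys)
  sum-support a {xs} {ys} xs! ys! xs⊆ys ys⊆xs = begin
    sum (map a xs)                         ≡⟨ sum-filter-nonzero a xs ⟨
    sum (map a (filter (nonzero? a) xs))   ≡⟨ sum-↭ (↭-map⁺ a perm) ⟩
    sum (map a (filter (nonzero? a) ys))   ≡⟨ sum-filter-nonzero a ys ⟩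
    sum (map a ys)                         ∎
    where
    open ≡-Reasoning
    restrict : ∀ {us vs : List I} → (∀ {i} → i ∈ₗ us → a i ≢ 0 → i ∈ₗ vs) →
               ∀ {i} → i ∈ₗ filter (nonzero? a) us → i ∈ₗ filter (nonzero? a) vs
    restrict us⊆vs i∈ =
      let i∈us , ai≢0 = ∈-filter⁻ (nonzero? a) i∈
      in  ∈-filter⁺ (nonzero? a) (us⊆vs i∈us ai≢0) ai≢0
    perm : filter (nonzero? a) xs ↭ filter (nonzero? a) ys
    perm = unique-↭ (Unique.filter⁺ (nonzero? a) xs!) (Unique.filter⁺ (nonzero? a) ys!)
                    (restrict xs⊆ys) (restrict ys⊆xs)

  sum-map-* : ∀ k (a : I → ℕ) xs → sum (map (λ i → k * a i) xs) ≡ k * sum (map a xs)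
  sum-map-* k a []       = sym (*-zeroʳ k)
  sum-map-* k a (x ∷ xs) =
    trans (cong (k * a x +_) (sum-map-* k a xs)) (sym (*-distribˡ-+ k (a x) _))

  sum-nonzero : ∀ (a : I → ℕ) xs → sum (map a xs) ≢ 0 →
                ∃ λ i → a i ≢ 0 × a i ≤ sum (map a xs)
  sum-nonzero a []       ≢0 = contradiction refl ≢0
  sum-nonzero a (x ∷ xs) ≢0 with a x ≟ 0
  ... | no  ax≢0 = x , ax≢0 , m≤m+n _ _
  ... | yes ax≡0 =
    let i , ai≢0 , ai≤ = sum-nonzero a xs (λ eq → ≢0 (cong₂ _+_ ax≡0 eq))
    in  i , ai≢0 , ≤-trans ai≤ (m≤n+m _ (a x))

  isSum-unique : ∀ {K : Subset I} {a m n} → IsSum K a m → IsSum K a n → m ≡ n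
  isSum-unique {a = a} s t =
    trans (sym (total s)) (trans (sum-support a (unique s) (unique t)
      (λ i∈ → covers t (All.lookup (inside s) i∈))
      (λ i∈ → covers s (All.lookup (inside t) i∈))) (total t))
    where open IsSum

  isSum-cong : ∀ {K : Subset I} {a b n} → (∀ {i} → i ∈ K → a i ≡ b i) →
               IsSum K a n → IsSum K b n
  isSum-cong a≡b s = record
    { support = support ; unique = unique ; inside = inside
    ; covers  = λ i∈K bi≢0 → covers i∈K (bi≢0 ∘ trans (sym (a≡b i∈K)))
    ; total   = trans (cong sum (sym (map-cong-local (All.map a≡b inside)))) total
    }
    where open IsSum s

  isSum-*⁺ : ∀ {K : Subset I} {a n} k → IsSum K a n → IsSum K (λ i → k * a i) (k * n)
  isSum-*⁺ {a = a} k s = record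
    { support = support ; unique = unique ; inside = inside
    ; covers  = λ i∈K kai≢0 →
        covers i∈K (λ ai≡0 → kai≢0 (trans (cong (k *_) ai≡0) (*-zeroʳ k)))
    ; total   = trans (sum-map-* k a support) (cong (k *_) total)
    }
    where open IsSum s

  isSum-*⁻ : ∀ {K : Subset I} {a n} k .⦃ _ : NonZero k ⦄ →
             IsSum K (λ i → k * a i) (k * n) → IsSum K a n
  isSum-*⁻ {a = a} {n} k s = record
    { support = support ; unique = unique ; inside = inside
    ; covers  = λ i∈K ai≢0 → covers i∈K
        (λ kai≡0 → ai≢0 (*-cancelˡ-≡ _ _ k (trans kai≡0 (sym (*-zeroʳ k)))))
    ; total   = *-cancelˡ-≡ _ _ k (trans (sym (sum-map-* k a support)) total)
    }
    where open IsSum s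

  isSum-restrict : ∀ {K : Subset I} {a n} → Decidable K → (∀ i → i ∉ K → a i ≡ 0) →
                   IsSum U a n → IsSum K a n
  isSum-restrict {K} {a} {n} K? vanish s = record
    { support = filter K? support
    ; unique  = Unique.filter⁺ K? unique
    ; inside  = All.tabulate (λ i∈ → proj₂ (∈-filter⁻ K? {xs = support} i∈))
    ; covers  = λ i∈K ai≢0 → ∈-filter⁺ K? (covers _ ai≢0) i∈K
    ; total   = trans (sum-support a (Unique.filter⁺ K? unique) unique
        (λ i∈ _ → proj₁ (∈-filter⁻ K? i∈))
        (λ i∈ ai≢0 → ∈-filter⁺ K? i∈ (decidable-stable (K? _) (ai≢0 ∘ vanish _))))
        total
    }
    where open IsSum s

  isSum-extend : ∀ {K : Subset I} {a n} → Decidable K → (∀ i → i ∉ K → a i ≡ 0) →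
                 IsSum K a n → IsSum U a n
  isSum-extend K? vanish s = record
    { support = support ; unique = unique ; inside = All.map _ inside
    ; covers  = λ _ ai≢0 → covers (decidable-stable (K? _) (ai≢0 ∘ vanish _)) ai≢0
    ; total   = total
    }
    where open IsSum s

  module _ (_≟ᵢ_ : DecidableEquality I) (i : I) where

    private
      other? : Decidable (_≢ i)
      other? j = ¬? (j ≟ᵢ i)

    isSum-insert : ∀ {a n} → IsSum (_≢ i) a n → IsSum U a (a i + n)
    isSum-insert {a} {n} s = record
      { support = i ∷ support
      ; unique  = All.map (λ j≢i i≡j → j≢i (sym i≡j)) inside ∷ unique
      ; inside  = All.tabulate _
      ; covers  = λ {j} _ aj≢0 → covers′ j aj≢0
      ; total   = cong (a i +_) total
      }
      where
      open IsSum s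
      covers′ : ∀ j → a j ≢ 0 → j ∈ₗ i ∷ support
      covers′ j aj≢0 with j ≟ᵢ i
      ... | yes j≡i = here j≡i
      ... | no  j≢i = there (covers j≢i aj≢0)

    -- Whether or not `i` lies in the support, filtering it out and inserting it again gives another
    -- sum of the same `a`, so the totals agree by `isSum-unique`.
    isSum-remove : ∀ {a n} → IsSum U a n → ∃ λ m → n ≡ a i + m × IsSum (_≢ i) a m
    isSum-remove {a} s = _ , isSum-unique s (isSum-insert rest) , rest
      where
      open IsSum s
      rest : IsSum (_≢ i) a (sum (map a (filter other? support)))
      rest = record
        { support = filter other? support
        ; unique  = Unique.filter⁺ other? unique
        ; inside  = All.tabulate (λ j∈ → proj₂ (∈-filter⁻ other? {xs = support} j∈))
        ; covers  = λ j≢i aj≢0 → ∈-filter⁺ other? (covers _ aj≢0) j≢i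
        ; total   = refl
        }

applyUpTo-cong : {X : Set} {f h : ℕ → X} → f ≗ h → ∀ N → applyUpTo f N ≡ applyUpTo h N
applyUpTo-cong f≗h zero    = refl
applyUpTo-cong f≗h (suc N) = cong₂ _∷_ (f≗h 0) (applyUpTo-cong (f≗h ∘ suc) N)

sum-applyUpTo-* : ∀ k f N → sum (applyUpTo (λ i → k * f i) N) ≡ k * sum (applyUpTo f N)
sum-applyUpTo-* k f zero    = sym (*-zeroʳ k)
sum-applyUpTo-* k f (suc N) =
  trans (cong (k * f 0 +_) (sum-applyUpTo-* k (f ∘ suc) N)) (sym (*-distribˡ-+ k (f 0) _))

-- Digit expansions

value : (ℕ → ℕ) → (ℕ → ℕ) → ℕ → ℕ
value g e N = sum (applyUpTo (λ i → G g i * e i) N)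

-- One Horner step, with the factor `g 0` on the right to match division with remainder.
value-suc : ∀ g e N → value g e (suc N) ≡ e 0 + value (g ∘ suc) (e ∘ suc) N * g 0
value-suc g e N = cong₂ _+_ (*-identityˡ (e 0)) (trans
  (trans (cong sum (applyUpTo-cong (λ i → *-assoc (g 0) (G (g ∘ suc) i) (e (suc i))) N))
         (sum-applyUpTo-* (g 0) (λ i → G (g ∘ suc) i * e (suc i)) N))
  (*-comm (g 0) _))

2≤⇒nonZero : ∀ {n} → 2 ≤ n → NonZero n
2≤⇒nonZero 2≤n = >-nonZero (<-≤-trans (s≤s z≤n) 2≤n)

-- Dividing by a base lowers an upper bound by one. This makes the digit recursions structural in
-- the bound instead of in the number.
/-≤-pred : ∀ {m N} g .⦃ _ : NonZero g ⦄ → 2 ≤ g → m ≤ suc N → m / g ≤ N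
/-≤-pred {zero}  g 2≤g m≤ = ≤-trans (≤-reflexive (0/n≡0 g)) z≤n
/-≤-pred {suc m} g 2≤g m≤ = s≤s⁻¹ (<-≤-trans (m/n<m (suc m) g 2≤g) m≤)

[r+q*g]%g≡r : ∀ {r} q g .⦃ _ : NonZero g ⦄ → r < g → (r + q * g) % g ≡ r
[r+q*g]%g≡r {r} q g r<g = trans ([m+kn]%n≡m%n r q g) (m<n⇒m%n≡m r<g)

[r+q*g]/g≡q : ∀ {r} q g .⦃ _ : NonZero g ⦄ → r < g → (r + q * g) / g ≡ q
[r+q*g]/g≡q {r} q g r<g = trans (+-distrib-/-∣ʳ r (n∣m*n q))
  (cong₂ _+_ (m<n⇒m/n≡0 r<g) (m*n/n≡m q g))

G≢0 : ∀ {g} → (∀ i → 2 ≤ g i) → ∀ i → NonZero (G g i)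
G≢0     2≤g zero    = _
G≢0 {g} 2≤g (suc i) = m*n≢0 (g 0) _ ⦃ 2≤⇒nonZero (2≤g 0) ⦄ ⦃ G≢0 (2≤g ∘ suc) i ⦄

digit : (g : ℕ → ℕ) → (∀ i → 2 ≤ g i) → ℕ → ℕ → ℕ
digit g 2≤g n zero    = n % g 0
  where instance _ = 2≤⇒nonZero (2≤g 0)
digit g 2≤g n (suc i) = digit (g ∘ suc) (2≤g ∘ suc) (n / g 0) i
  where instance _ = 2≤⇒nonZero (2≤g 0)

digit< : ∀ {g} 2≤g n i → digit g 2≤g n i < g i
digit< {g} 2≤g n zero    = m%n<n n (g 0)
  where instance _ = 2≤⇒nonZero (2≤g 0)
digit< {g} 2≤g n (suc i) = digit< (2≤g ∘ suc) _ i

digit-0 : ∀ {g} 2≤g i → digit g 2≤g 0 i ≡ 0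
digit-0 {g} 2≤g zero    = m*n%n≡0 0 (g 0)
  where instance _ = 2≤⇒nonZero (2≤g 0)
digit-0 {g} 2≤g (suc i) =
  trans (cong (λ n → digit (g ∘ suc) (2≤g ∘ suc) n i) (0/n≡0 (g 0))) (digit-0 (2≤g ∘ suc) i)
  where instance _ = 2≤⇒nonZero (2≤g 0)

digit-vanishes : ∀ {g} 2≤g {n i} → n ≤ i → digit g 2≤g n i ≡ 0
digit-vanishes 2≤g {i = zero}  z≤n = digit-0 2≤g 0
digit-vanishes {g} 2≤g {i = suc i} n≤i =
  digit-vanishes (2≤g ∘ suc) (/-≤-pred (g 0) (2≤g 0) n≤i)
  where instance _ = 2≤⇒nonZero (2≤g 0)

value-digit : ∀ {g} 2≤g {n N} → n ≤ N → value g (digit g 2≤g n) N ≡ n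
value-digit 2≤g {N = zero} z≤n = refl
value-digit {g} 2≤g {n} {suc N} n≤N = begin
  value g (digit g 2≤g n) (suc N)
    ≡⟨ value-suc g (digit g 2≤g n) N ⟩
  n % g 0 + value (g ∘ suc) (digit (g ∘ suc) (2≤g ∘ suc) (n / g 0)) N * g 0
    ≡⟨ cong (λ q → n % g 0 + q * g 0)
         (value-digit (2≤g ∘ suc) (/-≤-pred (g 0) (2≤g 0) n≤N)) ⟩
  n % g 0 + n / g 0 * g 0
    ≡⟨ m≡m%n+[m/n]*n n (g 0) ⟨
  n ∎
  where
  open ≡-Reasoning
  instance _ = 2≤⇒nonZero (2≤g 0)

digit-value : ∀ {g} 2≤g {e} → (∀ i → e i < g i) → ∀ {N} → (∀ i → N ≤ i → e i ≡ 0) →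
              digit g 2≤g (value g e N) ≗ e
digit-value 2≤g e<g {zero}  e≡0 i = trans (digit-0 2≤g i) (sym (e≡0 i z≤n))
digit-value {g} 2≤g {e} e<g {suc N} e≡0 zero =
  trans (cong (_% g 0) (value-suc g e N))
        ([r+q*g]%g≡r (value (g ∘ suc) (e ∘ suc) N) (g 0) (e<g 0))
  where instance _ = 2≤⇒nonZero (2≤g 0)
digit-value {g} 2≤g {e} e<g {suc N} e≡0 (suc i) = trans
  (cong (λ n → digit (g ∘ suc) (2≤g ∘ suc) n i)
    (trans (cong (_/ g 0) (value-suc g e N))
           ([r+q*g]/g≡q (value (g ∘ suc) (e ∘ suc) N) (g 0) (e<g 0))))
  (digit-value (2≤g ∘ suc) (e<g ∘ suc) (λ j N≤j → e≡0 (suc j) (s≤s N≤j)) i)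
  where instance _ = 2≤⇒nonZero (2≤g 0)

∈⇒≤sum : ∀ {n ns} → n ∈ₗ ns → n ≤ sum ns
∈⇒≤sum {ns = m ∷ ns} (here refl) = m≤m+n m _
∈⇒≤sum {ns = m ∷ ns} (there n∈)  = ≤-trans (∈⇒≤sum n∈) (m≤n+m _ m)

-- British number systems are additive systems.

module British (g : ℕ → ℕ) (2≤g : ∀ i → 2 ≤ g i) where

  part : ℕ → ℕ → ℕ
  part n i = G g i * digit g 2≤g n i

  part∈british : ∀ n i → part n i ∈ british g i
  part∈british n i = digit g 2≤g n i , digit< 2≤g n i , refl

  part-isSum : ∀ n → IsSum U (part n) n
  part-isSum n = record
    { support = upTo n
    ; unique  = Unique.upTo⁺ n
    ; inside  = All.tabulate _
    ; covers  = λ {i} _ part≢0 → ∈-upTo⁺ (≰⇒> (λ n≤i →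
        part≢0 (trans (cong (G g i *_) (digit-vanishes 2≤g n≤i)) (*-zeroʳ (G g i)))))
    ; total   = trans (cong sum (map-upTo (part n) n)) (value-digit 2≤g ≤-refl)
    }

  part-unique : ∀ {n a} → (∀ i → a i ∈ british g i) → IsSum U a n → part n ≗ a
  part-unique {n} {a} a∈ s i = trans (cong (G g i *_) (digit≡e i)) (Ge≡a i)
    where
    open IsSum s
    N : ℕ
    -- The support consists of natural numbers, each at most their sum, so `a` vanishes from `N` on.
    N = suc (sum support)
    e : ℕ → ℕ
    e i = proj₁ (a∈ i)
    Ge≡a : ∀ i → G g i * e i ≡ a i
    Ge≡a i = proj₂ (proj₂ (a∈ i))
    a-vanishes : ∀ i → N ≤ i → a i ≡ 0
    a-vanishes i N≤i = decidable-stable (a i ≟ 0)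
      (λ ai≢0 → <⇒≱ N≤i (∈⇒≤sum (covers _ ai≢0)))
    e-vanishes : ∀ i → N ≤ i → e i ≡ 0
    e-vanishes i N≤i = *-cancelˡ-≡ _ _ (G g i) ⦃ G≢0 2≤g i ⦄
      (trans (Ge≡a i) (trans (a-vanishes i N≤i) (sym (*-zeroʳ (G g i)))))
    value≡n : value g e N ≡ n
    value≡n = begin
      value g e N
        ≡⟨ cong sum (map-upTo (λ i → G g i * e i) N) ⟨
      sum (map (λ i → G g i * e i) (upTo N))
        ≡⟨ cong sum (map-cong-local (All.tabulate {xs = upTo N} (λ {i} _ → Ge≡a i))) ⟩
      sum (map a (upTo N))
        ≡⟨ sum-support a (Unique.upTo⁺ N) unique
             (λ _ → covers _) (λ i∈ _ → ∈-upTo⁺ (s≤s (∈⇒≤sum i∈))) ⟩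
      sum (map a support)
        ≡⟨ total ⟩
      n ∎
      where open ≡-Reasoning
    digit≡e : digit g 2≤g n ≗ e
    digit≡e i = trans (cong (λ n → digit g 2≤g n i) (sym value≡n))
      (digit-value 2≤g (λ i → proj₁ (proj₂ (a∈ i))) e-vanishes i)

  british-zero∈ : ∀ i → 0 ∈ british g i
  british-zero∈ i = 0 , <-≤-trans (s≤s z≤n) (2≤g i) , *-zeroʳ (G g i)

  british-G∈ : ∀ i → G g i ∈ british g i
  british-G∈ i = 1 , 2≤g i , *-identityʳ (G g i)

  british-isAdditiveSystem : IsAdditiveSystem (british g)
  british-isAdditiveSystem = record
    { index          = 0
    ; zero∈          = british-zero∈
    ; atLeastTwo     = λ i → 0 , G g i , british-zero∈ i , british-G∈ i ,
                             ≢-sym (≢-nonZero⁻¹ (G g i) ⦃ G≢0 2≤g i ⦄)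
    ; representation = λ n → part n , (part∈british n , part-isSum n) ,
                             λ (a∈ , s) → part-unique a∈ s
    }

-- Indecomposability and primality

length-cartesianProduct : {X Y : Set} (xs : List X) (ys : List Y) →
                          length (cartesianProduct xs ys) ≡ length xs * length ys
length-cartesianProduct []       ys = refl
length-cartesianProduct (x ∷ xs) ys = trans (length-++ (map (x ,_) ys))
  (cong₂ _+_ (length-map (x ,_) ys) (length-cartesianProduct xs ys))

2≤length : {X : Set} {x y : X} {xs : List X} → x ∈ₗ xs → y ∈ₗ xs → x ≢ y → 2 ≤ length xs
2≤length {xs = _ ∷ []}    (here refl) (here refl) x≢y = contradiction refl x≢y
2≤length {xs = _ ∷ _ ∷ _} _           _           _   = s≤s (s≤s z≤n)

-- Collects pointwise witnesses into one aligned list, so that an enumeration of `A` can be replaced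
-- by the list of representing pairs.
All-∃⇒preimages : {X Y : Set} {f : X → Y} {R : Subset X} {ys : List Y} →
                  All (λ y → ∃ λ x → R x × f x ≡ y) ys →
                  ∃ λ xs → map f xs ≡ ys × All R xs
All-∃⇒preimages [] = [] , refl , []
All-∃⇒preimages ((x , Rx , refl) ∷ rest) with All-∃⇒preimages rest
... | xs , refl , Rxs = x ∷ xs , refl , Rx ∷ Rxs

-- The pairs `rs` representing the listed elements of `A` are, by uniqueness of representations,
-- exactly the members of B × C. Their projections therefore enumerate `B` and `C`, and counting
-- pairs gives the product.
decomposable⇒length : ∀ {A} → Decomposable A → ∀ {as} → Unique as →
                      (∀ {a} → a ∈ A → a ∈ₗ as) → (∀ {a} → a ∈ₗ as → a ∈ A) →
                      ∃₂ λ m n → 2 ≤ m × 2 ≤ n × m * n ≡ length as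
decomposable⇒length (B , C , (b₀ , b₁ , b₀∈B , b₁∈B , b₀≢b₁) , (c₀ , c₁ , c₀∈C , c₁∈C , c₀≢c₁)
                     , A≐B+C , representation) {as} as! A⊆as as⊆A
  with All-∃⇒preimages {f = λ (b , c) → b ℤ.+ c} {R = λ (b , c) → b ∈ B × c ∈ C}
         (All.tabulate λ {a} a∈as →
           let r , (b∈B , c∈C , b+c≡a) , _ = representation a (as⊆A a∈as)
           in  r , (b∈B , c∈C) , b+c≡a)
... | rs , refl , rs⊆B×C =
  length bs , length cs ,
  2≤length (B⊆bs b₀∈B) (B⊆bs b₁∈B) b₀≢b₁ , 2≤length (C⊆cs c₀∈C) (C⊆cs c₁∈C) c₀≢c₁ ,
  (begin
    length bs * length cs                  ≡⟨ length-cartesianProduct bs cs ⟨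
    length (cartesianProduct bs cs)        ≡⟨ ↭-length (unique-↭
                                                (Unique.cartesianProduct⁺ bs! cs!)
                                                (Unique.map⁻ as!) product⊆rs rs⊆product) ⟩
    length rs                              ≡⟨ length-map _ rs ⟨
    length (map (λ (b , c) → b ℤ.+ c) rs)  ∎)
  where
  open ≡-Reasoning
  bs cs : List ℤ
  bs = deduplicate ℤ._≟_ (map proj₁ rs)
  cs = deduplicate ℤ._≟_ (map proj₂ rs)
  bs! : Unique bs
  bs! = DecUnique.deduplicate-! ℤ._≟_ (map proj₁ rs)
  cs! : Unique cs
  cs! = DecUnique.deduplicate-! ℤ._≟_ (map proj₂ rs)
  B×C⊆rs : ∀ {b c} → b ∈ B → c ∈ C → (b , c) ∈ₗ rs
  B×C⊆rs {b} {c} b∈B c∈C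
    with b+c∈A ← proj₂ A≐B+C (b , c , b∈B , c∈C , refl)
    with (b′ , c′) , r∈rs , eq ← ∈-map⁻ _ (A⊆as b+c∈A)
    with _ , _ , only ← representation (b ℤ.+ c) b+c∈A
    with b′∈B , c′∈C ← All.lookup rs⊆B×C r∈rs
    -- The pair found in `rs` and (b , c) have the same sum, so uniqueness identifies them.
    = subst (_∈ₗ rs) (trans (sym (only (b′∈B , c′∈C , sym eq))) (only (b∈B , c∈C , refl))) r∈rs
  rs⊆product : ∀ {r} → r ∈ₗ rs → r ∈ₗ cartesianProduct bs cs
  rs⊆product r∈rs = ∈-cartesianProduct⁺ (∈-deduplicate⁺ ℤ._≟_ (∈-map⁺ proj₁ r∈rs))
                                        (∈-deduplicate⁺ ℤ._≟_ (∈-map⁺ proj₂ r∈rs))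
  -- Pairing with a fixed element of the other summand makes each element appear as a projection.
  B⊆bs : ∀ {b} → b ∈ B → b ∈ₗ bs
  B⊆bs b∈B = ∈-deduplicate⁺ ℤ._≟_ (∈-map⁺ proj₁ (B×C⊆rs b∈B c₀∈C))
  C⊆cs : ∀ {c} → c ∈ C → c ∈ₗ cs
  C⊆cs c∈C = ∈-deduplicate⁺ ℤ._≟_ (∈-map⁺ proj₂ (B×C⊆rs b₀∈B c∈C))
  bs⊆B : ∀ {b} → b ∈ₗ bs → b ∈ B
  bs⊆B b∈bs with _ , r∈rs , refl ← ∈-map⁻ proj₁ (∈-deduplicate⁻ ℤ._≟_ (map proj₁ rs) b∈bs)
    = proj₁ (All.lookup rs⊆B×C r∈rs)
  cs⊆C : ∀ {c} → c ∈ₗ cs → c ∈ C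
  cs⊆C c∈cs with _ , r∈rs , refl ← ∈-map⁻ proj₂ (∈-deduplicate⁻ ℤ._≟_ (map proj₂ rs) c∈cs)
    = proj₂ (All.lookup rs⊆B×C r∈rs)
  product⊆rs : ∀ {r} → r ∈ₗ cartesianProduct bs cs → r ∈ₗ rs
  product⊆rs r∈ = let b∈bs , c∈cs = ∈-cartesianProduct⁻ bs cs r∈
                  in  B×C⊆rs (bs⊆B b∈bs) (cs⊆C c∈cs)

¬prime-* : ∀ {m n} → 2 ≤ m → 2 ≤ n → ¬ Prime (m * n)
¬prime-* {m} {n} 2≤m 2≤n p with prime⇒irreducible p (m∣m*n {m} n)
... | inj₁ refl  = contradiction 2≤m λ { (s≤s ()) }
... | inj₂ m≡m*n = <-irrefl m≡m*n (m<m*n m n ⦃ 2≤⇒nonZero 2≤m ⦄ 2≤n)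

prime⇒indecomposable : ∀ h .⦃ _ : NonZero h ⦄ {p} → Prime p →
                       ¬ Decomposable (image ℤ.+_ (h ∗ (_< p)))
prime⇒indecomposable h {p} isPrime D =
  let m , n , 2≤m , 2≤n , m*n≡p = decomposable⇒length D {as}
        (Unique.map⁺ (*-cancelˡ-≡ _ _ h ∘ ℤ.+-injective) (Unique.upTo⁺ p))
        (λ { (_ , (k , k<p , refl) , refl) → ∈-map⁺ _ (∈-upTo⁺ k<p) })
        (λ a∈as → let k , k∈ , a≡ = ∈-map⁻ _ a∈as
                  in  h * k , (k , ∈-upTo⁻ k∈ , refl) , sym a≡)
  in  ¬prime-* 2≤m 2≤n
        (subst Prime (sym (trans m*n≡p (trans (length-map _ (upTo p)) (length-upTo p)))) isPrime)
  where
  as : List ℤ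
  as = map (λ k → ℤ.+ (h * k)) (upTo p)

-- [0, a b) = [0, a) + a ∗ [0, b).
composite⇒decomposable : ∀ h .⦃ _ : NonZero h ⦄ {a b} → 2 ≤ a → 2 ≤ b →
                         Decomposable (image ℤ.+_ (h ∗ (_< b * a)))
composite⇒decomposable h {a} {b} 2≤a 2≤b =
  image ℤ.+_ (h ∗ (_< a)) , image ℤ.+_ ((h * a) ∗ (_< b)) ,
  two h 2≤a , two (h * a) 2≤b ,
  ((λ { (_ , (k , k< , refl) , refl) → _ , _ , split k k< }) ,
   (λ { (_ , _ , (_ , (r , r< , refl) , refl) , (_ , (q , q< , refl) , refl) , refl) →
        _ , (r + q * a , digits< r< q< , combine r q) , ℤ.pos-+ (h * r) (h * a * q) })) ,
  (λ { _ (_ , (k , k< , refl) , refl) → _ , split k k< ,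
       (λ { ((_ , (r , r< , refl) , refl) , (_ , (q , q< , refl) , refl) , eq) →
            recover k r q r< (sym (*-cancelˡ-≡ _ _ h
              (trans (combine r q) (ℤ.+-injective (trans (ℤ.pos-+ (h * r) (h * a * q)) eq))))) }) })
  where
  instance
    _ = 2≤⇒nonZero 2≤a
    _ = m*n≢0 h a
  two : ∀ k .⦃ _ : NonZero k ⦄ {n} → 2 ≤ n → AtLeastTwo (image ℤ.+_ (k ∗ (_< n)))
  two k 2≤n = ℤ.+ (k * 0) , ℤ.+ (k * 1) ,
    (_ , (0 , <-≤-trans (s≤s z≤n) 2≤n , refl) , refl) , (_ , (1 , 2≤n , refl) , refl) ,
    (λ eq → 0≢1+n (*-cancelˡ-≡ _ _ k (ℤ.+-injective eq)))
  combine : ∀ r q → h * (r + q * a) ≡ h * r + h * a * q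
  combine r q = trans (*-distribˡ-+ h r (q * a))
    (cong (h * r +_) (trans (cong (h *_) (*-comm q a)) (sym (*-assoc h a q))))
  digits< : ∀ {r q} → r < a → q < b → r + q * a < b * a
  digits< {r} {q} r<a q<b = <-≤-trans (+-monoˡ-< (q * a) r<a) (*-monoˡ-≤ a q<b)
  split : ∀ k → k < b * a →
          ℤ.+ (h * (k % a)) ∈ image ℤ.+_ (h ∗ (_< a)) ×
          ℤ.+ (h * a * (k / a)) ∈ image ℤ.+_ ((h * a) ∗ (_< b)) ×
          ℤ.+ (h * (k % a)) ℤ.+ ℤ.+ (h * a * (k / a)) ≡ ℤ.+ (h * k)
  split k k< = (_ , (k % a , m%n<n k a , refl) , refl) ,
    (_ , (k / a , m<n*o⇒m/o<n k< , refl) , refl) ,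
    trans (sym (ℤ.pos-+ (h * (k % a)) _)) (cong ℤ.+_ (trans (sym (combine (k % a) (k / a)))
      (cong (h *_) (sym (m≡m%n+[m/n]*n k a)))))
  recover : ∀ k r q → r < a → k ≡ r + q * a →
            (ℤ.+ (h * (k % a)) , ℤ.+ (h * a * (k / a))) ≡ (ℤ.+ (h * r) , ℤ.+ (h * a * q))
  recover k r q r<a refl = cong₂ (λ x y → ℤ.+ (h * x) , ℤ.+ (h * a * y))
    ([r+q*g]%g≡r q a r<a) ([r+q*g]/g≡q q a r<a)

decomposable-resp-≐ : ∀ {A A′} → A ≐ A′ → Decomposable (image ℤ.+_ A) → Decomposable (image ℤ.+_ A′)
decomposable-resp-≐ (A⊆A′ , A′⊆A) (B , C , 2≤B , 2≤C , (A⊆ , ⊆A) , representation) =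
  B , C , 2≤B , 2≤C ,
  ((λ { (_ , x∈A′ , refl) → A⊆ (_ , A′⊆A x∈A′ , refl) }) ,
   (λ r → let x , x∈A , x≡ = ⊆A r in x , A⊆A′ x∈A , x≡)) ,
  (λ { a (x , x∈A′ , x≡) → representation a (x , A′⊆A x∈A′ , x≡) })

prime⇒2≤ : ∀ {p} → Prime p → 2 ≤ p
prime⇒2≤ {p} isPrime = nonTrivial⇒n>1 p ⦃ prime⇒nonTrivial isPrime ⦄

-- Primality is decidable, so refuting compositeness suffices constructively. For g = q d with 1 < d
-- < g, the inequality d < q d also gives 1 < q.
indecomposable⇒prime : ∀ h .⦃ _ : NonZero h ⦄ {g} → 2 ≤ g →
                       ¬ Decomposable (image ℤ.+_ (h ∗ (_< g))) → Prime g
indecomposable⇒prime h {g} 2≤g indec = decidable-stable (prime? g) λ ¬prime →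
  let instance _ = n>1⇒nonTrivial 2≤g in
  ¬composite (¬prime⇒composite ¬prime)
  where
  ¬composite : ¬ Composite g
  ¬composite (composite {d} d<g (divides q refl)) = indec (composite⇒decomposable h
    (nonTrivial⇒n>1 d) (*-cancelʳ-< d 1 q (subst (_< q * d) (sym (*-identityˡ d)) d<g)))

british-indecomposable : ∀ p → IsIndecomposable (british (terms p))
british-indecomposable p i =
  prime⇒indecomposable (G (terms p) i) ⦃ G≢0 (prime⇒2≤ ∘ prime p) i ⦄ (prime p i)

-- Mutual divisibility shows that the products `G g i` and `G g′ i` agree. If one term were smaller,
-- its multiple of this product would lie in the set of the larger term, hence in its own set,
-- making the term smaller than itself.
british-injective : ∀ {g g′} → (∀ i → 2 ≤ g i) → (∀ i → 2 ≤ g′ i) →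
                    (∀ i → british g i ≐ british g′ i) → g ≗ g′
british-injective {g} {g′} 2≤g 2≤g′ same i =
  ≤-antisym (≮⇒≥ λ g′<g → <-irrefl refl (bound 2≤g′ (proj₁ (same i) (_ , g′<g , cong (_* g′ i) G≡G′))))
            (≮⇒≥ λ g<g′ → <-irrefl refl (bound 2≤g (proj₂ (same i) (_ , g<g′ , cong (_* g i) (sym G≡G′)))))
  where
  -- G g i is the element of british g i with digit 1, and every element of british g′ i is
  -- a multiple of G g′ i.
  divides-G : ∀ {g g′} → (∀ i → 2 ≤ g i) → british g i ⊆ british g′ i → G g′ i ∣ G g i
  divides-G {g} {g′} 2≤g ⊆′ =
    let k , _ , G′k≡G = ⊆′ (British.british-G∈ g 2≤g i) in divides k (trans (sym G′k≡G) (*-comm _ k))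
  G≡G′ : G g i ≡ G g′ i
  G≡G′ = ∣-antisym (divides-G 2≤g′ (proj₂ (same i))) (divides-G 2≤g (proj₁ (same i)))
  bound : ∀ {g k} → (∀ i → 2 ≤ g i) → G g i * k ∈ british g i → k < g i
  bound {g} 2≤g (_ , j< , eq) = subst (_< g i) (*-cancelˡ-≡ _ _ (G g i) ⦃ G≢0 2≤g i ⦄ eq) j<

-- Direct sums A ⊕ C = ℕ

module DirectSum
  {A C : Subset ℕ}
  (0∈A : 0 ∈ A) (0∈C : 0 ∈ C)
  (cover : ∀ n → ∃₂ λ a c → a ∈ A × c ∈ C × a + c ≡ n)
  (cancel : ∀ {a a′ c c′} → a ∈ A → a′ ∈ A → c ∈ C → c′ ∈ C → a + c ≡ a′ + c′ → a ≡ a′)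
  where

  A∩C⊆0 : ∀ {n} → n ∈ A → n ∈ C → n ≡ 0
  A∩C⊆0 n∈A n∈C = cancel n∈A 0∈A 0∈C n∈C (+-identityʳ _)

  -- In g = a + c with both summands positive, c is below g and hence in both `A` and `C`, which is
  -- impossible; with c = 0, g itself would be in `A`. So a = 0.
  least∉⇒∈ : ∀ {g} → (∀ {r} → r < g → r ∈ A) → g ∉ A → g ∈ C
  least∉⇒∈ {g} below g∉A with cover g
  ... | a , zero  , a∈A , _   , refl = contradiction (subst A (sym (+-identityʳ a)) a∈A) g∉A
  ... | zero  , c , _   , c∈C , refl = c∈C
  ... | suc a , c@(suc _) , _ , c∈C , refl =
    contradiction (A∩C⊆0 (below (m<n+m c (s≤s z≤n))) c∈C) λ ()

  module _ {g : ℕ} .⦃ _ : NonZero g ⦄ (below : ∀ {r} → r < g → r ∈ A) (g∈C : g ∈ C) where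

    -- Both halves concern the block [k g, k g + g) and are proved together by strong induction,
    -- because each relies on both for earlier blocks.
    Tiled : ℕ → Set
    Tiled k = (∀ {r} → r < g → r + k * g ∈ C → r ≡ 0) ×
              (∀ {r s} → r < g → s < g → r + k * g ∈ A → s + k * g ∈ A)

    private
      0<g : 0 < g
      0<g = >-nonZero⁻¹ g

    module _ (k : ℕ) .⦃ _ : NonZero k ⦄ (tiled : ∀ {j} → j < k → Tiled j) where

      private
        g≤k*g : g ≤ k * g
        g≤k*g = m≤n*m g k

        k*g≢0 : k * g ≢ 0
        k*g≢0 = ≢-nonZero⁻¹ (k * g) ⦃ m*n≢0 k g ⦄

        multiple : ∀ {c} → c ∈ C → c / g < k → c ≡ c / g * g
        multiple {c} c∈C c/g<k = trans (m≡m%n+[m/n]*n c g) (cong (_+ c / g * g)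
          (proj₁ (tiled c/g<k) (m%n<n c g) (subst C (m≡m%n+[m/n]*n c g) c∈C)))

        [d+q]*g≡k*g : ∀ d q → q + d ≡ k → d * g + q * g ≡ k * g
        [d+q]*g≡k*g d q q+d≡k =
          trans (sym (*-distribʳ-+ g d q)) (cong (_* g) (trans (+-comm d q) q+d≡k))

        shift : ∀ d q {s} → q + d ≡ k → s + d * g + q * g ≡ s + k * g
        shift d q {s} q+d≡k = trans (+-assoc s (d * g) (q * g)) (cong (s +_) ([d+q]*g≡k*g d q q+d≡k))

        d<k : ∀ d q → q * g ≢ 0 → q + d ≡ k → d < k
        d<k d zero    q*g≢0 _     = contradiction refl q*g≢0
        d<k d (suc q) _     q+d≡k = subst (d <_) q+d≡k (s≤s (m≤n+m d q))

      -- Here c = q g and a = d g with d < k, so r + k g = (r + d g) + q g for all r < g.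
      tiled-from-sum : ∀ {a c} → a ∈ A → c ∈ C → c ≢ 0 → a + c ≡ k * g → Tiled k
      tiled-from-sum {a} {c} a∈A c∈C c≢0 a+c≡k*g =
        (λ {r} r<g r+k*g∈C → m+n≡0⇒m≡0 r (sym
          (cancel 0∈A (r+d*g∈A r<g) r+k*g∈C q*g∈C (sym (shift d q q+d≡k))))) ,
        -- Here the block misses `A`: otherwise (r + k g) + 0 and (r + d g) + q g would be two
        -- representations, forcing d = k.
        (λ {r} r<g _ r+k*g∈A → contradiction
          (*-cancelʳ-≡ _ _ g (+-cancelˡ-≡ r _ _ (cancel (r+d*g∈A r<g) r+k*g∈A q*g∈C 0∈C
            (trans (shift d q q+d≡k) (sym (+-identityʳ _))))))
          (<⇒≢ d<k′))
        where
        decomposed : ∃ λ q → c ≡ q * g × q ≤ k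
        decomposed with m≤n⇒m<n∨m≡n (m+n≤o⇒n≤o a (≤-reflexive a+c≡k*g))
        ... | inj₁ c<k*g = c / g , multiple c∈C c/g<k , <⇒≤ c/g<k
          where
          c/g<k : c / g < k
          c/g<k = m<n*o⇒m/o<n c<k*g
        ... | inj₂ c≡k*g = k , c≡k*g , ≤-refl
        q d : ℕ
        q = proj₁ decomposed
        d = k ∸ q
        c≡q*g : c ≡ q * g
        c≡q*g = proj₁ (proj₂ decomposed)
        q+d≡k : q + d ≡ k
        q+d≡k = m+[n∸m]≡n (proj₂ (proj₂ decomposed))
        q*g∈C : q * g ∈ C
        q*g∈C = subst C c≡q*g c∈C
        d<k′ : d < k
        d<k′ = d<k d q (c≢0 ∘ trans c≡q*g) q+d≡k
        a≡d*g : a ≡ d * g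
        a≡d*g = +-cancelʳ-≡ c a (d * g) (trans a+c≡k*g
          (trans (sym ([d+q]*g≡k*g d q q+d≡k)) (cong (λ x → d * g + x) (sym c≡q*g))))
        r+d*g∈A : ∀ {r} → r < g → r + d * g ∈ A
        r+d*g∈A r<g = proj₂ (tiled d<k′) 0<g r<g (subst A a≡d*g a∈A)

      tiled-from-A : k * g ∈ A → Tiled k
      tiled-from-A k*g∈A = (λ r<g r+k*g∈C → contradiction r+k*g∈C (outside r<g)) ,
                           (λ _ s<g _ → inside s<g)
        where
        -- For 0 < r, (k + 1) g would be both (g - r) + (r + k g) and k g + g.
        outside : ∀ {r} → r < g → r + k * g ∉ C
        outside {zero}      _   k*g∈C   = k*g≢0 (A∩C⊆0 k*g∈A k*g∈C)
        outside {r@(suc _)} r<g r+k*g∈C = <⇒≢ (<-≤-trans g∸r<g g≤k*g)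
          (cancel (below g∸r<g) k*g∈A r+k*g∈C g∈C (begin
            g ∸ r + (r + k * g)  ≡⟨ +-assoc (g ∸ r) r (k * g) ⟨
            g ∸ r + r + k * g    ≡⟨ cong (_+ k * g) (m∸n+n≡m (<⇒≤ r<g)) ⟩
            g + k * g            ≡⟨ +-comm g (k * g) ⟩
            k * g + g            ∎))
          where
          open ≡-Reasoning
          g∸r<g : g ∸ r < g
          g∸r<g = ∸-monoʳ-< (s≤s z≤n) (<⇒≤ r<g)
        inside : ∀ {s} → s < g → s + k * g ∈ A
        inside {s} s<g with cover (s + k * g)
        ... | a , c , a∈A , c∈C , a+c≡s+k*g with c ≟ 0
        ...   | yes refl = subst A (trans (sym (+-identityʳ a)) a+c≡s+k*g) a∈A
        ...   | no  c≢0  with m≤n⇒m<n∨m≡n c/g≤k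
          where
          c/g≤k : c / g ≤ k
          c/g≤k = ≤-trans (/-monoˡ-≤ g (m+n≤o⇒n≤o a (≤-reflexive a+c≡s+k*g)))
                          (≤-reflexive ([r+q*g]/g≡q k g s<g))
        ...     | inj₂ c/g≡k = contradiction c∈C (subst (_∉ C)
                    (sym (trans (m≡m%n+[m/n]*n c g) (cong (λ q → c % g + q * g) c/g≡k)))
                    (outside (m%n<n c g)))
        -- With c in an earlier block, c = q g and a = s + d g for d = k - q, so d g is in `A` by
        -- tiling. Then d g + q g is a second representation of k g besides k g + 0.
        ...     | inj₁ c/g<k with m≤n⇒∃[o]m+o≡n (<⇒≤ c/g<k)
        ...       | d , q+d≡k = contradiction
                    (*-cancelʳ-≡ _ _ g (cancel d*g∈A k*g∈A q*g∈C 0∈C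
                      (trans ([d+q]*g≡k*g d (c / g) q+d≡k) (sym (+-identityʳ (k * g))))))
                    (<⇒≢ d<k′)
          where
          c≡q*g : c ≡ c / g * g
          c≡q*g = multiple c∈C c/g<k
          q*g∈C : c / g * g ∈ C
          q*g∈C = subst C c≡q*g c∈C
          d<k′ : d < k
          d<k′ = d<k d (c / g) (c≢0 ∘ trans c≡q*g) q+d≡k
          a≡s+d*g : a ≡ s + d * g
          a≡s+d*g = +-cancelʳ-≡ c a (s + d * g) (trans a+c≡s+k*g
            (trans (sym (shift d (c / g) q+d≡k)) (cong (λ x → s + d * g + x) (sym c≡q*g))))
          d*g∈A : d * g ∈ A
          d*g∈A = proj₂ (tiled d<k′) s<g 0<g (subst A a≡s+d*g a∈A)

    tiled : ∀ k → Tiled k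
    tiled = <-rec Tiled step
      where
      step : ∀ k → (∀ {j} → j < k → Tiled j) → Tiled k
      step zero    _ =
        (λ {r} r<g r+0∈C → A∩C⊆0 (below r<g) (subst C (+-identityʳ r) r+0∈C)) ,
        (λ {_} {s} _ s<g _ → subst A (sym (+-identityʳ s)) (below s<g))
      step k@(suc _) ih with cover (k * g)
      ... | a , c , a∈A , c∈C , a+c≡kg with c ≟ 0
      ...   | no  c≢0  = tiled-from-sum k ih a∈A c∈C c≢0 a+c≡kg
      ...   | yes refl = tiled-from-A k ih (subst A (trans (sym (+-identityʳ a)) a+c≡kg) a∈A)

-- Prime divisors, least elements and passage to smaller blocks.

prime-divisor : ∀ {n} → 2 ≤ n → ∃ λ p → Prime p × p ∣ n
prime-divisor {n} 2≤n with factorise n ⦃ 2≤⇒nonZero 2≤n ⦄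
... | record { factors = []    ; isFactorisation = refl } = contradiction 2≤n λ { (s≤s ()) }
... | record { factors = p ∷ ps ; isFactorisation = refl ; factorsPrime = isPrime ∷ _ } =
  p , isPrime , m∣m*n (product ps)

least : ∀ {P : Subset ℕ} → Decidable P → ∀ n → n ∈ P →
        ∃ λ m → m ∈ P × (∀ {k} → k < m → k ∉ P)
least {P} P? = <-rec _ step
  where
  step : ∀ n → (∀ {m} → m < n → m ∈ P → ∃ λ m → m ∈ P × (∀ {k} → k < m → k ∉ P)) →
         n ∈ P → ∃ λ m → m ∈ P × (∀ {k} → k < m → k ∉ P)
  step n ih n∈P with anyUpTo? P? n
  ... | yes (m , m<n , m∈P) = ih m<n m∈P
  ... | no  none            = n , n∈P , λ k<n k∈P → none (_ , k<n , k∈P)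

Blocks : ℕ → Subset ℕ → Set
Blocks p A = ∀ q {r s} → r < p → s < p → r + q * p ∈ A → s + q * p ∈ A

-- For g = h p, each block of length p lies inside one block of length g: split q by division by h.
blocks-∣ : ∀ {p g A} .⦃ _ : NonZero g ⦄ → p ∣ g → Blocks g A → Blocks p A
blocks-∣ {p} {A = A} (divides h refl) blocks q {r} {s} r<p s<p r∈ =
  subst A (sym (regroup s)) (blocks (q / h) (bound r<p) (bound s<p) (subst A (regroup r) r∈))
  where
  instance _ = m*n≢0⇒m≢0 h
  bound : ∀ {r} → r < p → r + q % h * p < h * p
  bound {r} r<p = <-≤-trans (+-monoˡ-< (q % h * p) r<p) (*-monoˡ-≤ p (m%n<n q h))
  regroup : ∀ r → r + q * p ≡ r + q % h * p + q / h * (h * p)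
  regroup r = begin
    r + q * p                              ≡⟨ cong (λ q → r + q * p) (m≡m%n+[m/n]*n q h) ⟩
    r + (q % h + q / h * h) * p            ≡⟨ cong (r +_) (*-distribʳ-+ p (q % h) (q / h * h)) ⟩
    r + (q % h * p + q / h * h * p)        ≡⟨ +-assoc r _ _ ⟨
    r + q % h * p + q / h * h * p          ≡⟨ cong (λ x → r + q % h * p + x) (*-assoc (q / h) h p) ⟩
    r + q % h * p + q / h * (h * p)        ∎
    where open ≡-Reasoning

-- Additive systems as contractions

-- Unlike in an additive system, members may be {0}: dividing out digits can exhaust them.
record WeakSystem (I : Set) : Set₁ where
  field
    family         : Family I
    zero∈          : ∀ i → 0 ∈ family i
    representation : ∀ n → ∃! _≗_ λ a → (∀ i → a i ∈ family i) × IsSum U a n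

-- One step of digit extraction: the lowest digit in base `base` is free in the pivot member and
-- zero in every other member.
record Splitting {I : Set} (A : Family I) : Set where
  field
    base    : ℕ
    isPrime : Prime base
    pivot   : I
    others  : ∀ {n} → n ∈ Sumset (_≢ pivot) A → base ∣ n
    blocks  : Blocks base (A pivot)

module Classical (em : ExcludedMiddle 0ℓ) {I : Set} where

  infix 4 _≟ᵢ_
  _≟ᵢ_ : DecidableEquality I
  _ ≟ᵢ _ = em

  override : I → ℕ → (I → ℕ) → I → ℕ
  override i x b j with j ≟ᵢ i
  ... | yes _ = x
  ... | no  _ = b j

  override-≡ : ∀ i x b → override i x b i ≡ x
  override-≡ i x b with i ≟ᵢ i
  ... | yes _   = refl
  ... | no  i≢i = contradiction refl i≢i

  override-≢ : ∀ {i x b j} → j ≢ i → override i x b j ≡ b j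
  override-≢ {i} {j = j} j≢i with j ≟ᵢ i
  ... | yes j≡i = contradiction j≡i j≢i
  ... | no  _   = refl

  override∈ : ∀ {A : Family I} {i x b} → x ∈ A i → (∀ j → j ≢ i → b j ∈ A j) →
              ∀ j → override i x b j ∈ A j
  override∈ {i = i} x∈ b∈ j with j ≟ᵢ i
  ... | yes refl = x∈
  ... | no  j≢i  = b∈ j j≢i

  isSum-override : ∀ {i x b n} → IsSum (_≢ i) b n → IsSum U (override i x b) (x + n)
  isSum-override {i} {x} {b} s = subst (λ y → IsSum U (override i x b) (y + _)) (override-≡ i x b)
    (isSum-insert _≟ᵢ_ i (isSum-cong (λ j≢i → sym (override-≢ j≢i)) s))

  0∈sumset : ∀ {K : Subset I} {A} → (∀ i → 0 ∈ A i) → 0 ∈ Sumset K A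
  0∈sumset zero∈ = (λ _ → 0) , (λ i _ → zero∈ i) , record
    { support = [] ; unique = [] ; inside = []
    ; covers  = λ _ 0≢0 → contradiction refl 0≢0 ; total = refl }

  ∈-sumset : ∀ {A : Family I} {i j x} → (∀ i → 0 ∈ A i) → i ≢ j → x ∈ A i → x ∈ Sumset (_≢ j) A
  ∈-sumset {A} {i} {j} {x} zero∈ i≢j x∈ =
    override i x (λ _ → 0) , (λ k _ → override∈ {A} x∈ (λ k _ → zero∈ k) k) , record
      { support = i ∷ []
      ; unique  = [] ∷ []
      ; inside  = i≢j ∷ []
      ; covers  = λ {k} _ ≢0 → here (decidable-stable (k ≟ᵢ i) (≢0 ∘ override-≢))
      ; total   = trans (+-identityʳ _) (override-≡ i x _)
      }

  module _ (W : WeakSystem I) where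
    open WeakSystem W

    private
      cover : ∀ i n → ∃₂ λ a c → a ∈ family i × c ∈ Sumset (_≢ i) family × a + c ≡ n
      cover i n =
        let a , (a∈ , s) , _ = representation n
            m , n≡ , t       = isSum-remove _≟ᵢ_ i s
        in  a i , m , a∈ i , (a , (λ j _ → a∈ j) , t) , sym n≡

      -- Overriding each representation by the complementary sumset at index `i` yields two
      -- representations of one number in the whole system, which are then compared at `i`.
      cancel : ∀ i {a a′ c c′} → a ∈ family i → a′ ∈ family i → c ∈ Sumset (_≢ i) family →
               c′ ∈ Sumset (_≢ i) family → a + c ≡ a′ + c′ → a ≡ a′
      cancel i {a} {a′} {c} {c′} a∈ a′∈ (b , b∈ , s) (b′ , b′∈ , s′) eq =
        let d , _ , only = representation (a + c)
        in  begin
          a                  ≡⟨ override-≡ i a b ⟨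
          override i a b i   ≡⟨ only (override∈ {family} a∈ b∈ , isSum-override s) i ⟨
          d i                ≡⟨ only (override∈ {family} a′∈ b′∈ ,
                                  subst (IsSum U _) (sym eq) (isSum-override s′)) i ⟩
          override i a′ b′ i ≡⟨ override-≡ i a′ b′ ⟩
          a′                 ∎
        where open ≡-Reasoning

      module Sum (i : I) = DirectSum {family i} {Sumset (_≢ i) family}
        (zero∈ i) (0∈sumset {A = family} zero∈) (cover i) (cancel i)

    -- A nonzero summand of a sum equal to 1 is itself 1. Its index serves as pivot.
    one∈ : ∃ λ i → 1 ∈ family i
    one∈ =
      let a , (a∈ , s) , _  = representation 1
          i , ai≢0 , ai≤sum = sum-nonzero a (support s) (subst (_≢ 0) (sym (total s)) λ ())
          ai≡1              = ≤-antisym (subst (a i ≤_) (total s) ai≤sum) (n≢0⇒n>0 ai≢0)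
      in  i , subst (family i) ai≡1 (a∈ i)
      where open IsSum

    splitting : Splitting family
    splitting with one∈
    ... | i , 1∈ with em {∃ λ n → n ∉ family i}
    ...   | no  full = record
      -- An arbitrary prime: the pivot member is all of ℕ, so the other members sum to 0 only.
      { base    = 2
      ; isPrime = prime[2]
      ; pivot   = i
      ; others  = λ {n} n∈C → subst (2 ∣_) (sym (Sum.A∩C⊆0 i (all∈ n) n∈C)) (2 ∣0)
      ; blocks  = λ _ _ _ _ → all∈ _
      }
      where
      all∈ : ∀ n → n ∈ family i
      all∈ n = decidable-stable em (λ n∉ → full (n , n∉))
    ...   | yes (n , n∉) = record
      { base    = p
      ; isPrime = proj₁ (proj₂ (prime-divisor 2≤g))
      ; pivot   = i
      -- Tiling makes n mod g vanish, so n is a multiple of g and hence of p.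
      ; others  = λ {n} n∈C → ∣-trans p∣g (m%n≡0⇒n∣m n g
          (proj₁ (Sum.tiled i below g∈C (n / g)) (m%n<n n g)
                 (subst (Sumset (_≢ i) family) (m≡m%n+[m/n]*n n g) n∈C)))
      ; blocks  = blocks-∣ {A = family i} p∣g (λ q → proj₂ (Sum.tiled i below g∈C q))
      }
      where
      found : ∃ λ g → g ∉ family i × (∀ {r} → r < g → ¬ (r ∉ family i))
      found = least (λ _ → em) n n∉
      g : ℕ
      g = proj₁ found
      g∉ : g ∉ family i
      g∉ = proj₁ (proj₂ found)
      below : ∀ {r} → r < g → r ∈ family i
      below r<g = decidable-stable em (proj₂ (proj₂ found) r<g)
      2≤g : 2 ≤ g
      2≤g = at-least-2 g g∉
        where
        at-least-2 : ∀ g → g ∉ family i → 2 ≤ g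
        at-least-2 0             0∉ = contradiction (zero∈ i) 0∉
        at-least-2 1             1∉ = contradiction 1∈ 1∉
        at-least-2 (suc (suc _)) _  = s≤s (s≤s z≤n)
      instance _ = 2≤⇒nonZero 2≤g
      p : ℕ
      p = proj₁ (prime-divisor 2≤g)
      p∣g : p ∣ g
      p∣g = proj₂ (proj₂ (prime-divisor 2≤g))
      g∈C : g ∈ Sumset (_≢ i) family
      g∈C = Sum.least∉⇒∈ i below g∉

    open Splitting splitting public

    private instance
      base≢0 : NonZero base
      base≢0 = 2≤⇒nonZero (prime⇒2≤ isPrime)

    base∣other : ∀ {i x} → i ≢ pivot → x ∈ family i → base ∣ x
    base∣other i≢pivot x∈ = others (∈-sumset {family} zero∈ i≢pivot x∈)

    -- At the pivot, the summand is the difference of `base * n` and the sum of the others, both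
    -- multiples of `base`.
    base∣summand : ∀ {a n} → (∀ i → a i ∈ family i) → IsSum U a (base * n) → ∀ i → base ∣ a i
    base∣summand {a} {n} a∈ s i with i ≟ᵢ pivot
    ... | no  i≢pivot = base∣other i≢pivot (a∈ i)
    ... | yes refl    =
      let m , base*n≡ai+m , t = isSum-remove _≟ᵢ_ pivot s
      in  ∣m+n∣m⇒∣n (subst (base ∣_) (trans base*n≡ai+m (+-comm (a pivot) m)) (m∣m*n n))
                    (others (a , (λ j _ → a∈ j) , t))

    -- Representations of n correspond to those of `base * n` through scaling, since every summand
    -- of the latter is a multiple of `base`.
    quotientSystem : WeakSystem I
    quotientSystem = record
      { family         = λ i b → base * b ∈ family i
      ; zero∈          = λ i → subst (family i) (sym (*-zeroʳ base)) (zero∈ i)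
      ; representation = λ n →
          let a , (a∈ , s) , only = representation (base * n)
              scaled : ∀ i → base * (a i / base) ≡ a i
              scaled i = m*[n/m]≡n (base∣summand a∈ s i)
          in  (λ i → a i / base) ,
              ((λ i → subst (family i) (sym (scaled i)) (a∈ i)) ,
               isSum-*⁻ base (isSum-cong (λ {i} _ → sym (scaled i)) s)) ,
              (λ (b∈ , t) i → *-cancelˡ-≡ _ _ base
                (trans (scaled i) (only (b∈ , isSum-*⁺ base t) i)))
      }

    private
      split : ∀ x → x ≡ x % base + x / base * base
      split x = m≡m%n+[m/n]*n x base

    ∈⇒remainder≡0 : ∀ {i x} → i ≢ pivot → x ∈ family i → x % base ≡ 0
    ∈⇒remainder≡0 i≢pivot x∈ = n∣m⇒m%n≡0 _ base (base∣other i≢pivot x∈)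

    -- Clearing the lowest digit stays within a block for the pivot and changes nothing for the
    -- other members.
    ∈⇒quotient∈ : ∀ {i x} → x ∈ family i → base * (x / base) ∈ family i
    ∈⇒quotient∈ {i} {x} x∈ with i ≟ᵢ pivot
    ... | no  i≢pivot = subst (family i) (sym (m*[n/m]≡n (base∣other i≢pivot x∈))) x∈
    ... | yes refl    = subst (family i) (*-comm (x / base) base)
      (blocks (x / base) (m%n<n x base) (>-nonZero⁻¹ base) (subst (family i) (split x) x∈))

    quotient∈⇒∈ : ∀ {i x} → (i ≢ pivot → x % base ≡ 0) → base * (x / base) ∈ family i → x ∈ family i
    quotient∈⇒∈ {i} {x} remainder≡0 q∈ with i ≟ᵢ pivot
    ... | no  i≢pivot = subst (family i)
      (sym (trans (split x) (cong₂ _+_ (remainder≡0 i≢pivot) (*-comm (x / base) base)))) q∈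
    ... | yes refl    = subst (family i) (sym (split x))
      (blocks (x / base) (>-nonZero⁻¹ base) (m%n<n x base) (subst (family i) (*-comm base (x / base)) q∈))

  -- Iterated quotients and the description of members by digits.

  bases : WeakSystem I → ℕ → ℕ
  bases W zero    = base W
  bases W (suc m) = bases (quotientSystem W) m

  pivots : WeakSystem I → ℕ → I
  pivots W zero    = pivot W
  pivots W (suc m) = pivots (quotientSystem W) m

  bases-prime : ∀ W m → Prime (bases W m)
  bases-prime W zero    = isPrime W
  bases-prime W (suc m) = bases-prime (quotientSystem W) m

  2≤bases : ∀ W m → 2 ≤ bases W m
  2≤bases W m = prime⇒2≤ (bases-prime W m)

  digitOf : WeakSystem I → ℕ → ℕ → ℕ
  digitOf W = digit (bases W) (2≤bases W)

  open WeakSystem using (family; zero∈)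

  ∈⇒digit≡0 : ∀ W {i x} → x ∈ family W i → ∀ m → pivots W m ≢ i → digitOf W x m ≡ 0
  ∈⇒digit≡0 W x∈ zero    ≢i = ∈⇒remainder≡0 W (≢-sym ≢i) x∈
  ∈⇒digit≡0 W x∈ (suc m) ≢i = ∈⇒digit≡0 (quotientSystem W) (∈⇒quotient∈ W x∈) m ≢i

  -- Induction on the bound `N`: the quotient of x has a smaller bound, and the bound 0 leaves only
  -- 0, which lies in every member.
  digit≡0⇒∈ : ∀ W {i x N} → x ≤ N → (∀ m → pivots W m ≢ i → digitOf W x m ≡ 0) → x ∈ family W i
  digit≡0⇒∈ W         {N = zero}  z≤n digit≡0 = zero∈ W _
  digit≡0⇒∈ W {i} {x} {suc N} x≤N digit≡0 = quotient∈⇒∈ W (λ i≢pivot → digit≡0 0 (≢-sym i≢pivot))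
    (digit≡0⇒∈ (quotientSystem W) (/-≤-pred (base W) (2≤bases W 0) x≤N) (digit≡0 ∘ suc))
    where instance _ = 2≤⇒nonZero (2≤bases W 0)

  module _ (W : WeakSystem I) where

    open British (bases W) (2≤bases W)

    private
      K : I → Subset ℕ
      K i m = pivots W m ≡ i

    -- Forwards, the digit parts of x vanish off `K i`. Backwards, uniqueness of expansions
    -- identifies the given summands with the digit parts of x, so its digits vanish there.
    family≐sumset : ∀ i → family W i ≐ Sumset (K i) (british (bases W))
    family≐sumset i = to , from
      where
      to : ∀ {x} → x ∈ family W i → x ∈ Sumset (K i) (british (bases W))
      to {x} x∈ = part x , (λ m _ → part∈british x m) ,
        isSum-restrict (λ _ → em)
          (λ m ≢i → trans (cong (G (bases W) m *_) (∈⇒digit≡0 W x∈ m ≢i)) (*-zeroʳ (G (bases W) m)))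
          (part-isSum x)
      from : ∀ {x} → x ∈ Sumset (K i) (british (bases W)) → x ∈ family W i
      from {x} (b , b∈ , s) = digit≡0⇒∈ W ≤-refl λ m ≢i →
        *-cancelˡ-≡ _ _ (G (bases W) m) ⦃ G≢0 (2≤bases W) m ⦄
          (trans (part-unique c∈ c-isSum m) (trans (c-outside ≢i) (sym (*-zeroʳ (G (bases W) m)))))
        where
        -- The values of `b` outside `K i` are arbitrary, so they are replaced by 0 to obtain a sum
        -- over all indices.
        c : ℕ → ℕ
        c m with em {K i m}
        ... | yes _ = b m
        ... | no  _ = 0
        c∈ : ∀ m → c m ∈ british (bases W) m
        c∈ m with em {K i m}
        ... | yes m∈ = b∈ m m∈
        ... | no  _  = british-zero∈ m
        c-outside : ∀ {m} → m ∉ K i → c m ≡ 0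
        c-outside {m} m∉ with em {K i m}
        ... | yes m∈ = contradiction m∈ m∉
        ... | no  _  = refl
        c-inside : ∀ {m} → m ∈ K i → b m ≡ c m
        c-inside {m} m∈ with em {K i m}
        ... | yes _  = refl
        ... | no  m∉ = contradiction m∈ m∉
        c-isSum : IsSum U c x
        c-isSum = isSum-extend (λ _ → em) (λ _ → c-outside) (isSum-cong c-inside s)

    -- A nonzero x has a nonzero digit, whose position must have pivot `i`. This makes the parts of
    -- the partition nonempty.
    pivots-hit : ∀ {i x} → x ∈ family W i → x ≢ 0 → ∃ λ m → pivots W m ≡ i
    pivots-hit {i} {x} x∈ x≢0 =
      let m , part≢0 , _ = sum-nonzero (part x) (IsSum.support (part-isSum x)) (subst (_≢ 0) (sym (IsSum.total (part-isSum x))) x≢0)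
      in  m , decidable-stable em (λ ≢i → part≢0
            (trans (cong (G (bases W) m *_) (∈⇒digit≡0 W x∈ m ≢i)) (*-zeroʳ (G (bases W) m))))

    contraction : (∀ i → AtLeastTwo (family W i)) → family W IsContractionOf british (bases W)
    contraction two = K , record
      { nonempty = nonempty
      ; disjoint = λ i≢i′ (≡i , ≡i′) → i≢i′ (trans (sym ≡i) ≡i′)
      ; covering = λ m → pivots W m , refl
      } , family≐sumset
      where
      nonempty : ∀ i → ∃ λ m → pivots W m ≡ i
      nonempty i with two i
      ... | x , y , x∈ , y∈ , x≢y with x ≟ 0
      ...   | no  x≢0  = pivots-hit x∈ x≢0
      ...   | yes refl = pivots-hit y∈ (≢-sym x≢y)

-- The correspondence with prime sequences, and the theorem.

british-cong : ∀ {g g′} → g ≗ g′ → ∀ i → british g i ≐ british g′ i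
british-cong {g} {g′} g≗g′ i =
  subst₂ (λ h n → british g i ≐ h ∗ (_< n))
         (cong product (applyUpTo-cong g≗g′ i)) (g≗g′ i) ≐-refl

indecomposableBritishSystem : PrimeSequence → IndecomposableBritishSystem
indecomposableBritishSystem p = record
  { sets           = british (terms p)
  ; additive       = British.british-isAdditiveSystem (terms p) (prime⇒2≤ ∘ prime p)
  ; isBritish      = terms p , prime⇒2≤ ∘ prime p , λ _ → ≐-refl
  ; indecomposable = british-indecomposable p
  }

primeSequences⤖systems : Bijection primeSequences indecomposableBritishSystems
primeSequences⤖systems = record
  { to        = indecomposableBritishSystem
  ; cong      = british-cong
  ; bijective =
      (λ {p} {q} → british-injective (prime⇒2≤ ∘ prime p) (prime⇒2≤ ∘ prime q)) ,
      -- Surjectivity: the generating sequence of `S` is the preimage, its terms being prime because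
      -- the members of `S` are indecomposable.
      (λ S → let g , 2≤g , S≐british = isBritish S in
        record
          { terms = g
          ; prime = λ i → indecomposable⇒prime (G g i) ⦃ G≢0 2≤g i ⦄ (2≤g i)
                            (indecomposable S i ∘ decomposable-resp-≐ (≐-sym (S≐british i)))
          } ,
        λ z≗g i → ≐-trans (british-cong z≗g i) (≐-sym (S≐british i)))
  }
  where open IndecomposableBritishSystem

theorem5 : (Σ[ 𝒜 ∈ Bijection primeSequences indecomposableBritishSystems ]
    (∀ (p : PrimeSequence) (i : ℕ) → sets (Bijection.to 𝒜 p) i ≐ british (terms p) i))
    ×
    (ExcludedMiddle 0ℓ →
    ∀ (I : Set) (A : Family I) → IsAdditiveSystem A →
    IsIndecomposable A
    ⊎ (∃₂ λ (J : Set) (B : Family J) →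
    IsAdditiveSystem B × IsIndecomposable B × A IsContractionOf B))
theorem5 =
  (primeSequences⤖systems , λ _ _ → ≐-refl) ,
  λ em I A isAdditive →
    let open IsAdditiveSystem isAdditive
        open Classical em
        W = record { family = A ; zero∈ = zero∈ ; representation = representation }
    in  inj₂ (ℕ , british (bases W) ,
              British.british-isAdditiveSystem (bases W) (2≤bases W) ,
              british-indecomposable (record { terms = bases W ; prime = bases-prime W }) ,
              contraction W atLeastTwo)
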